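{- The Block-Stacking Problem without counterbalancing is equivalent to the Airplane Refueling Problem, in the following sense. (1) Let $B$ be a finite set of $n\ge 1$ blocks with half-widths $w_i\ge 0$ and masses $m_i>0$. Consider the instance of the Airplane Refueling Problem with airplanes $A=B$, fuel consumption rates $c_i=m_i$ and tank volumes $v_i=w_im_i$. Then a bijection $\pi\colon B\to\{1,\dots,n\}$ is an optimal stacking order for the block instance if and only if its reverse $i\mapsto n+1-\pi(i)$ is an optimal dropout order for the airplane instance. (2) Let $A$ be a finite set of $n\ge 1$ airplanes with tank volumes $v_i\ge 0$ and fuel consumption rates $c_i>0$. Consider the instance of the Block-Stacking Problem without counterbalancing with $B=A$, $m_i=c_i$ and $w_i=v_i/c_i$. Then a bijection $\pi\colon A\to\{1,\dots,n\}$ is an optimal dropout order for the airplane instance if and only if its reverse $i\mapsto n+1-\pi(i)$ is an optimal stacking order for the block instance.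
   Context: Block-Stacking Problem without counterbalancing: given a finite set $B$ of $n$ blocks with half-widths $w_i\ge0$ and masses $m_i>0$, an optimal stacking order is a bijection $\pi\colon B\to\{1,\dots,n\}$ (order from top to bottom) maximizing $\sum_{i\in B} w_im_i/M_i$, where $M_i=\sum_{j:\,\pi(j)\le\pi(i)}m_j$. (This is the maximum overhang of a fully right-aligned stack in the order $\pi$.) Airplane Refueling Problem: given a finite set $A$ of $n$ airplanes with tank volumes $v_i\ge 0$ and fuel consumption rates $c_i>0$, an optimal dropout order is a bijection $\pi\colon A\to\{1,\dots,n\}$ (airplane $i$ is the $\pi(i)$-th to drop out) maximizing the range $\sum_{i\in A}v_i/C_i$, where $C_i=\sum_{j:\,\pi(j)\ge\pi(i)}c_j$. -}

module Defs where

open import Level using (_⊔_; 0ℓ) renaming (suc to lsuc)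
open import Algebra.Apartness.Bundles using (HeytingField)
open import Algebra.Bundles using (CommutativeRing)
open import Data.Bool.Base using (if_then_else_)
open import Data.Fin.Base using (Fin; zero; suc) renaming (_≤_ to _≤ᶠ_; _≥_ to _≥ᶠ_)
import Data.Fin.Permutation as Perm
import Data.Fin.Properties as Fin
open import Data.Nat.Base using (ℕ)
open import Data.Product.Base using (_,_; proj₁; proj₂)
import Data.Rational.Base as ℚ
import Data.Rational.Properties as ℚ
open import Data.Sum.Base using (_⊎_; inj₁; inj₂)
open import Function.Base using (_∘_)
open import Function.Bundles using (_↔_; Inverse)
open import Function.Construct.Composition using (_↔-∘_)
open import Relation.Binary.Core using (Rel)
open import Relation.Binary.Definitions using (tri<; tri≈; tri>)
import Relation.Binary.PropositionalEquality as ≡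
open import Relation.Binary.Structures using (IsStrictPartialOrder)
open import Relation.Nullary using (¬_; does; yes; no; contradiction)
open import Relation.Unary using (Pred; Decidable)

-- Ordered fields. Trichotomy is not required (only that apartness means
-- "less or greater"), so the axioms are satisfied by ℚ, by classical ℝ and by
-- constructive versions of ℝ. Given trichotomy, they are the usual axioms.
record OrderedField c ℓ₁ ℓ₂ ℓ₃ : Set (lsuc (c ⊔ ℓ₁ ⊔ ℓ₂ ⊔ ℓ₃)) where
  infix 4 _<_ _≤_
  field
    heytingField : HeytingField c ℓ₁ ℓ₂

  open HeytingField heytingField public

  field
    _<_                    : Rel Carrier ℓ₃
    <-isStrictPartialOrder : IsStrictPartialOrder _≈_ _<_
    <⇒#                    : ∀ {x y} → x < y → x # y
    #⇒<⊎>                  : ∀ {x y} → x # y → x < y ⊎ y < x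
    +-monoˡ-<              : ∀ {x y} z → x < y → x + z < y + z
    0<x∧0<y⇒0<x*y          : ∀ {x y} → 0# < x → 0# < y → 0# < x * y

  open IsStrictPartialOrder <-isStrictPartialOrder public
    using (<-respʳ-≈; <-respˡ-≈)
    renaming (irrefl to <-irrefl; trans to <-trans)

  _≤_ : Rel Carrier ℓ₃
  x ≤ y = ¬ (y < x)

  commutativeRing : CommutativeRing c ℓ₁
  commutativeRing = record { isCommutativeRing = isCommutativeRing }

  infix  8 _⁻¹[_]
  infixl 7 _/_[_]

  -- By uniqueness of inverses, the positivity proof does not affect the value
  -- up to _≈_.
  _⁻¹[_] : ∀ y → 0# < y → Carrier
  y ⁻¹[ 0<y ] = proj₁ (#⇒invertible (#-sym (<⇒# 0<y)))

  _/_[_] : Carrier → ∀ y → 0# < y → Carrier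
  x / y [ 0<y ] = x * y ⁻¹[ 0<y ]

-- ℚ shows that the axioms are consistent.
ℚ-orderedField : OrderedField 0ℓ 0ℓ 0ℓ 0ℓ
ℚ-orderedField = record
  { heytingField           = ℚ.heytingField
  ; _<_                    = ℚ._<_
  ; <-isStrictPartialOrder = ℚ.<-isStrictPartialOrder
  ; <⇒#                    = λ x<y x≡y → ℚ.<-irrefl x≡y x<y
  ; #⇒<⊎>                  = ≢⇒<⊎>
  ; +-monoˡ-<              = λ z → ℚ.+-monoˡ-< z
  ; 0<x∧0<y⇒0<x*y          = λ {x} {y} 0<x 0<y →
      ℚ.positive⁻¹ (x ℚ.* y)
        {{ℚ.pos*pos⇒pos x {{ℚ.positive 0<x}} y {{ℚ.positive 0<y}}}}
  }
  where
  ≢⇒<⊎> : ∀ {x y} → x ≡.≢ y → x ℚ.< y ⊎ y ℚ.< x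
  ≢⇒<⊎> {x} {y} x≢y with ℚ.<-cmp x y
  ... | tri< x<y _ _ = inj₁ x<y
  ... | tri≈ _ x≡y _ = contradiction x≡y x≢y
  ... | tri> _ _ y<x = inj₂ y<x

module OrderedFieldProperties {c ℓ₁ ℓ₂ ℓ₃} (F : OrderedField c ℓ₁ ℓ₂ ℓ₃) where
  open OrderedField F hiding (zero)
  open CommutativeRing commutativeRing
    using (ring; +-commutativeMonoid)
  open import Algebra.Properties.Ring ring using (-0#≈0#; -‿distribˡ-*; -‿involutive)
  open import Algebra.Properties.CommutativeMonoid.Sum +-commutativeMonoid using (sum)
  open import Relation.Binary.Reasoning.Setoid setoid

  x*x⁻¹≈1 : ∀ {x} (0<x : 0# < x) → x * x ⁻¹[ 0<x ] ≈ 1#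
  x*x⁻¹≈1 {x} 0<x = begin
    x * x ⁻¹[ 0<x ]         ≈⟨ *-congʳ (trans (+-congˡ -0#≈0#) (+-identityʳ x)) ⟨
    (x - 0#) * x ⁻¹[ 0<x ]  ≈⟨ proj₂ (proj₂ (#⇒invertible (#-sym (<⇒# 0<x)))) ⟩
    1#                      ∎

  x<0⇒0<-x : ∀ {x} → x < 0# → 0# < - x
  x<0⇒0<-x {x} x<0 =
    <-respˡ-≈ (-‿inverseʳ x) (<-respʳ-≈ (+-identityˡ (- x)) (+-monoˡ-< (- x) x<0))

  0<-x⇒x<0 : ∀ {x} → 0# < - x → x < 0#
  0<-x⇒x<0 {x} 0<-x =
    <-respˡ-≈ (+-identityˡ x) (<-respʳ-≈ (-‿inverseˡ x) (+-monoˡ-< x 0<-x))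

  x<0∧0<y⇒x*y<0 : ∀ {x y} → x < 0# → 0# < y → x * y < 0#
  x<0∧0<y⇒x*y<0 {x} {y} x<0 0<y = 0<-x⇒x<0
    (<-respʳ-≈ (sym (-‿distribˡ-* x y)) (0<x∧0<y⇒0<x*y (x<0⇒0<-x x<0) 0<y))

  0<1 : 0# < 1#
  0<1 with #⇒<⊎> (invertible⇒# (1# , 1*[1-0]≈1 , trans (*-comm _ _) 1*[1-0]≈1))
    where
    1*[1-0]≈1 : 1# * (1# - 0#) ≈ 1#
    1*[1-0]≈1 = trans (*-identityˡ _) (trans (+-congˡ -0#≈0#) (+-identityʳ 1#))
  ... | inj₂ 0<1# = 0<1#
  ... | inj₁ 1<0  = <-respʳ-≈ -1*-1≈1 (0<x∧0<y⇒0<x*y (x<0⇒0<-x 1<0) (x<0⇒0<-x 1<0))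
    where
    -1*-1≈1 : - 1# * - 1# ≈ 1#
    -1*-1≈1 = begin
      - 1# * - 1#    ≈⟨ -‿distribˡ-* 1# (- 1#) ⟨
      - (1# * - 1#)  ≈⟨ -‿cong (*-identityˡ (- 1#)) ⟩
      - - 1#         ≈⟨ -‿involutive 1# ⟩
      1#             ∎

  0<x⇒0<x⁻¹ : ∀ {x} (0<x : 0# < x) → 0# < x ⁻¹[ 0<x ]
  0<x⇒0<x⁻¹ {x} 0<x with #⇒<⊎> (invertible⇒# (x , left , trans (*-comm _ _) left))
    where
    left : x * (x ⁻¹[ 0<x ] - 0#) ≈ 1#
    left = trans (*-congˡ (trans (+-congˡ -0#≈0#) (+-identityʳ _))) (x*x⁻¹≈1 0<x)
  ... | inj₂ 0<x⁻¹ = 0<x⁻¹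
  ... | inj₁ x⁻¹<0 = contradiction
    (<-trans 0<1 (<-respˡ-≈ (trans (*-comm _ _) (x*x⁻¹≈1 0<x)) (x<0∧0<y⇒x*y<0 x⁻¹<0 0<x)))
    (<-irrefl refl)

  0≤x∧0<y⇒0≤x*y : ∀ {x y} → 0# ≤ x → 0# < y → 0# ≤ x * y
  0≤x∧0<y⇒0≤x*y {x} {y} 0≤x 0<y xy<0 =
    0≤x (<-respˡ-≈ xyy⁻¹≈x (x<0∧0<y⇒x*y<0 xy<0 (0<x⇒0<x⁻¹ 0<y)))
    where
    xyy⁻¹≈x : x * y * y ⁻¹[ 0<y ] ≈ x
    xyy⁻¹≈x = begin
      x * y * y ⁻¹[ 0<y ]    ≈⟨ *-assoc x y _ ⟩
      x * (y * y ⁻¹[ 0<y ])  ≈⟨ *-congˡ (x*x⁻¹≈1 0<y) ⟩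
      x * 1#                 ≈⟨ *-identityʳ x ⟩
      x                      ∎

  0≤x∧0<y⇒0≤x/y : ∀ {x y} → 0# ≤ x → (0<y : 0# < y) → 0# ≤ x / y [ 0<y ]
  0≤x∧0<y⇒0≤x/y 0≤x 0<y = 0≤x∧0<y⇒0≤x*y 0≤x (0<x⇒0<x⁻¹ 0<y)

  Zero⊎Positive : Carrier → Set (ℓ₁ ⊔ ℓ₃)
  Zero⊎Positive x = x ≈ 0# ⊎ 0# < x

  0<x⇒0<x+y : ∀ {x y} → 0# < x → Zero⊎Positive y → 0# < x + y
  0<x⇒0<x+y {x} 0<x (inj₁ y≈0) =
    <-respʳ-≈ (sym (trans (+-congˡ y≈0) (+-identityʳ x))) 0<x
  0<x⇒0<x+y {x} {y} 0<x (inj₂ 0<y) =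
    <-trans 0<y (<-respˡ-≈ (+-identityˡ y) (+-monoˡ-< y 0<x))

  sum-zero⊎positive : ∀ {n} (f : Fin n → Carrier) →
                      (∀ k → Zero⊎Positive (f k)) → Zero⊎Positive (sum f)
  sum-zero⊎positive {ℕ.zero}  f f≥0 = inj₁ refl
  sum-zero⊎positive {ℕ.suc n} f f≥0
    with f≥0 zero | sum-zero⊎positive (f ∘ suc) (f≥0 ∘ suc)
  ... | inj₁ f₀≈0 | inj₁ s≈0 = inj₁ (trans (+-cong f₀≈0 s≈0) (+-identityˡ 0#))
  ... | inj₁ f₀≈0 | inj₂ 0<s = inj₂ (<-respʳ-≈ (+-comm _ _) (0<x⇒0<x+y 0<s (inj₁ f₀≈0)))
  ... | inj₂ 0<f₀ | s≥0      = inj₂ (0<x⇒0<x+y 0<f₀ s≥0)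

  sum-positive : ∀ {n} (f : Fin n → Carrier) → (∀ k → Zero⊎Positive (f k)) →
                 ∀ k → 0# < f k → 0# < sum f
  sum-positive f f≥0 zero    0<fk = 0<x⇒0<x+y 0<fk (sum-zero⊎positive (f ∘ suc) (f≥0 ∘ suc))
  sum-positive f f≥0 (suc k) 0<fk = <-respʳ-≈ (+-comm _ _)
    (0<x⇒0<x+y (sum-positive (f ∘ suc) (f≥0 ∘ suc) k 0<fk) (f≥0 zero))

module FiniteSum {c ℓ₁ ℓ₂ ℓ₃} (F : OrderedField c ℓ₁ ℓ₂ ℓ₃)
                 {a n} {X : Set a} (enum : X ↔ Fin n) where
  open OrderedField F
  open OrderedFieldProperties F
  open CommutativeRing commutativeRing using (+-commutativeMonoid)
  open import Algebra.Properties.CommutativeMonoid.Sum +-commutativeMonoid using (sum)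

  ∑ : (X → Carrier) → Carrier
  ∑ f = sum (f ∘ Inverse.from enum)

  restrict : ∀ {p} {P : Pred X p} → Decidable P → (X → Carrier) → X → Carrier
  restrict P? f i = if does (P? i) then f i else 0#

  ∑∣ : ∀ {p} {P : Pred X p} → Decidable P → (X → Carrier) → Carrier
  ∑∣ P? f = ∑ (restrict P? f)

  ∑∣-positive : ∀ {p} {P : Pred X p} (P? : Decidable P) (f : X → Carrier) →
                (∀ i → 0# < f i) → ∀ i → P i → 0# < ∑∣ P? f
  ∑∣-positive {P = P} P? f 0<f i Pi =
    sum-positive _ (nonneg ∘ Inverse.from enum) (Inverse.to enum i)
      (≡.subst (λ j → 0# < restrict P? f j) (≡.sym (Inverse.strictlyInverseʳ enum i)) pos)
    where
    nonneg : ∀ j → Zero⊎Positive (restrict P? f j)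
    nonneg j with P? j
    ... | yes _ = inj₂ (0<f j)
    ... | no  _ = inj₁ refl

    pos : 0# < restrict P? f i
    pos with P? i
    ... | yes _  = 0<f i
    ... | no ¬Pi = contradiction Pi ¬Pi

-- Positions are 0-based: position p ∈ {1,…,n} is the element p - 1 of Fin n.
Order : ∀ {a} → Set a → ℕ → Set a
Order X n = X ↔ Fin n

-- In 0-based positions, p ↦ n + 1 - p is k ↦ n - 1 - k, which is `opposite`.
reverseOrder : ∀ {a n} {X : Set a} → Order X n → Order X n
reverseOrder π = Perm.reverse ↔-∘ π

module _ {ℓ₀ ℓ₁ ℓ₂ ℓ₃} (F : OrderedField ℓ₀ ℓ₁ ℓ₂ ℓ₃) where
  open OrderedField F
  open OrderedFieldProperties F

  record Blocks {a} (B : Set a) : Set (a ⊔ ℓ₀ ⊔ ℓ₃) where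
    field
      w   : B → Carrier
      m   : B → Carrier
      0≤w : ∀ i → 0# ≤ w i
      0<m : ∀ i → 0# < m i

  record Airplanes {a} (A : Set a) : Set (a ⊔ ℓ₀ ⊔ ℓ₃) where
    field
      v   : A → Carrier
      c   : A → Carrier
      0≤v : ∀ i → 0# ≤ v i
      0<c : ∀ i → 0# < c i

  blocks⇒airplanes : ∀ {a} {B : Set a} → Blocks B → Airplanes B
  blocks⇒airplanes I = record
    { v   = λ i → w i * m i
    ; c   = m
    ; 0≤v = λ i → 0≤x∧0<y⇒0≤x*y (0≤w i) (0<m i)
    ; 0<c = 0<m
    }
    where open Blocks I

  airplanes⇒blocks : ∀ {a} {A : Set a} → Airplanes A → Blocks A
  airplanes⇒blocks J = record
    { w   = λ i → v i / c i [ 0<c i ]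
    ; m   = c
    ; 0≤w = λ i → 0≤x∧0<y⇒0≤x/y (0≤v i) (0<c i)
    ; 0<m = 0<c
    }
    where open Airplanes J

  module BlockStacking {a n} {B : Set a} (enum : B ↔ Fin n) (I : Blocks B) where
    open Blocks I
    open FiniteSum F enum

    notBelow? : (π : Order B n) (i : B) → Decidable (λ j → Inverse.to π j ≤ᶠ Inverse.to π i)
    notBelow? π i j = Inverse.to π j Fin.≤? Inverse.to π i

    M : Order B n → B → Carrier
    M π i = ∑∣ (notBelow? π i) m

    0<M : ∀ π i → 0# < M π i
    0<M π i = ∑∣-positive (notBelow? π i) m 0<m i Fin.≤-refl

    overhang : Order B n → Carrier
    overhang π = ∑ λ i → w i * m i / M π i [ 0<M π i ]

    IsOptimalStackingOrder : Order B n → Set (a ⊔ ℓ₃)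
    IsOptimalStackingOrder π = ∀ σ → overhang σ ≤ overhang π

  module AirplaneRefueling {a n} {A : Set a} (enum : A ↔ Fin n) (J : Airplanes A) where
    open Airplanes J
    open FiniteSum F enum

    notBefore? : (π : Order A n) (i : A) → Decidable (λ j → Inverse.to π j ≥ᶠ Inverse.to π i)
    notBefore? π i j = Inverse.to π i Fin.≤? Inverse.to π j

    C : Order A n → A → Carrier
    C π i = ∑∣ (notBefore? π i) c

    0<C : ∀ π i → 0# < C π i
    0<C π i = ∑∣-positive (notBefore? π i) c 0<c i Fin.≤-refl

    range : Order A n → Carrier
    range π = ∑ λ i → v i / C π i [ 0<C π i ]

    IsOptimalDropoutOrder : Order A n → Set (a ⊔ ℓ₃)
    IsOptimalDropoutOrder π = ∀ σ → range σ ≤ range π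

  open BlockStacking public using (IsOptimalStackingOrder)
  open AirplaneRefueling public using (IsOptimalDropoutOrder)

{-# OPTIONS --safe #-}
module Submission where

-- Reversing an order turns "not below i" into "does not drop out before i", so
-- the partial mass sums M of an order are the partial rate sums C of its
-- reverse. As w m corresponds to v, the overhang of an order is the range of
-- its reverse, and reversal is an involution on the orders.

open import Defs
open import Algebra.Bundles using (CommutativeRing)
open import Data.Bool.Base using (true; false)
open import Data.Nat.Base using (ℕ; _≥_; s≤s)
import Data.Nat.Properties as ℕ
open import Data.Fin.Base using (Fin; opposite) renaming (_≤_ to _≤ᶠ_)
open import Data.Fin.Properties using (opposite-prop; opposite-involutive)
open import Data.Product.Base using (_×_; _,_)
open import Function.Base using (_∘_)
open import Function.Bundles using (_↔_; _⇔_; mk⇔; Inverse)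
open import Function.Properties.Equivalence using () renaming (sym to ⇔-sym)
open import Relation.Binary.PropositionalEquality using (subst₂)
open import Relation.Nullary.Decidable using (does; does-⇔)
open import Relation.Unary using (Pred; Decidable)

opposite-antimono-≤ : ∀ {n} {i j : Fin n} → i ≤ᶠ j → opposite j ≤ᶠ opposite i
opposite-antimono-≤ {n} {i} {j} i≤j
  -- The value of `opposite i` is `n ∸ suc i` because positions start at 0; hence the `s≤s`.
  rewrite opposite-prop i | opposite-prop j = ℕ.∸-monoʳ-≤ n (s≤s i≤j)

opposite-cancel-≤ : ∀ {n} {i j : Fin n} → opposite j ≤ᶠ opposite i → i ≤ᶠ j
opposite-cancel-≤ {i = i} {j} =
  subst₂ _≤ᶠ_ (opposite-involutive i) (opposite-involutive j) ∘ opposite-antimono-≤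

-- Stated through comparisons of positions, which are all that the partial sums depend on. The
-- relation is symmetric, so reversing twice never has to be identified with the identity as an
-- equation between bijections.
Reversed : ∀ {a n} {X : Set a} → Order X n → Order X n → Set a
Reversed π ρ = ∀ i j → Inverse.to π j ≤ᶠ Inverse.to π i ⇔ Inverse.to ρ i ≤ᶠ Inverse.to ρ j

reverseOrder-reversed : ∀ {a n} {X : Set a} (π : Order X n) → Reversed π (reverseOrder π)
reverseOrder-reversed π i j = mk⇔ opposite-antimono-≤ opposite-cancel-≤

reversed-sym : ∀ {a n} {X : Set a} (π ρ : Order X n) → Reversed π ρ → Reversed ρ π
reversed-sym π ρ rev i j = ⇔-sym (rev j i)

module _ {ℓ₀ ℓ₁ ℓ₂ ℓ₃} (F : OrderedField ℓ₀ ℓ₁ ℓ₂ ℓ₃) where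
  open OrderedField F
  open OrderedFieldProperties F
  open CommutativeRing commutativeRing using (+-commutativeMonoid)
  open import Algebra.Properties.CommutativeMonoid.Sum +-commutativeMonoid
    using (sum-cong-≋)
  open import Relation.Binary.Reasoning.Setoid setoid

  -- Uniqueness of inverses. The two positivity proofs are unrelated, so the value of an inverse is
  -- independent of the proof as well.
  ⁻¹-cong : ∀ {x y} (0<x : 0# < x) (0<y : 0# < y) → x ≈ y → x ⁻¹[ 0<x ] ≈ y ⁻¹[ 0<y ]
  ⁻¹-cong {x} {y} 0<x 0<y x≈y = begin
    x ⁻¹[ 0<x ]                      ≈⟨ *-identityʳ _ ⟨
    x ⁻¹[ 0<x ] * 1#                 ≈⟨ *-congˡ (x*x⁻¹≈1 0<y) ⟨
    x ⁻¹[ 0<x ] * (y * y ⁻¹[ 0<y ])  ≈⟨ *-assoc _ _ _ ⟨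
    x ⁻¹[ 0<x ] * y * y ⁻¹[ 0<y ]    ≈⟨ *-congʳ (*-comm _ _) ⟩
    y * x ⁻¹[ 0<x ] * y ⁻¹[ 0<y ]    ≈⟨ *-congʳ (*-congʳ x≈y) ⟨
    x * x ⁻¹[ 0<x ] * y ⁻¹[ 0<y ]    ≈⟨ *-congʳ (x*x⁻¹≈1 0<x) ⟩
    1# * y ⁻¹[ 0<y ]                 ≈⟨ *-identityˡ _ ⟩
    y ⁻¹[ 0<y ]                      ∎

  /-cong : ∀ {x x′ y y′} (0<y : 0# < y) (0<y′ : 0# < y′) →
           x ≈ x′ → y ≈ y′ → x / y [ 0<y ] ≈ x′ / y′ [ 0<y′ ]
  /-cong 0<y 0<y′ x≈x′ y≈y′ = *-cong x≈x′ (⁻¹-cong 0<y 0<y′ y≈y′)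

  x/y*y≈x : ∀ x {y} (0<y : 0# < y) → x / y [ 0<y ] * y ≈ x
  x/y*y≈x x {y} 0<y = begin
    x * y ⁻¹[ 0<y ] * y    ≈⟨ *-assoc _ _ _ ⟩
    x * (y ⁻¹[ 0<y ] * y)  ≈⟨ *-congˡ (*-comm _ _) ⟩
    x * (y * y ⁻¹[ 0<y ])  ≈⟨ *-congˡ (x*x⁻¹≈1 0<y) ⟩
    x * 1#                 ≈⟨ *-identityʳ x ⟩
    x                      ∎

  ≤-resp₂-≈ : ∀ {x x′ y y′} → x ≈ x′ → y ≈ y′ → x ≤ y → x′ ≤ y′
  ≤-resp₂-≈ x≈x′ y≈y′ x≤y y′<x′ = x≤y (<-respˡ-≈ (sym y≈y′) (<-respʳ-≈ (sym x≈x′) y′<x′))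

  module _ {a n} {X : Set a} (enum : X ↔ Fin n) where
    open FiniteSum F enum

    ∑-cong : ∀ {f g : X → Carrier} → (∀ i → f i ≈ g i) → ∑ f ≈ ∑ g
    ∑-cong f≈g = sum-cong-≋ (f≈g ∘ Inverse.from enum)

    ∑∣-cong-⇔ : ∀ {p q} {P : Pred X p} {Q : Pred X q} (P? : Decidable P) (Q? : Decidable Q) →
                (∀ i → P i ⇔ Q i) → ∀ {f g} → (∀ i → f i ≈ g i) → ∑∣ P? f ≈ ∑∣ Q? g
    ∑∣-cong-⇔ P? Q? P⇔Q {f} {g} f≈g = ∑-cong restrict-cong
      where
      restrict-cong : ∀ i → restrict P? f i ≈ restrict Q? g i
      -- Decisions of equivalent propositions have the same Boolean, so one case split settles both
      -- conditionals.
      restrict-cong i rewrite does-⇔ (P⇔Q i) (P? i) (Q? i) with does (Q? i)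
      ... | true  = f≈g i
      ... | false = refl

    module _ (I : Blocks F X) (J : Airplanes F X) where
      open Blocks I
      open Airplanes J
      open BlockStacking F enum I
      open AirplaneRefueling F enum J

      -- The two instances are related only up to `≈`, so that the lemma serves both translations:
      -- from blocks to airplanes and back.
      overhang≈range : (∀ i → w i * m i ≈ v i) → (∀ i → m i ≈ c i) →
                       ∀ π ρ → Reversed π ρ → overhang π ≈ range ρ
      overhang≈range wm≈v m≈c π ρ rev = ∑-cong λ i →
        /-cong (0<M π i) (0<C ρ i) (wm≈v i)
          (∑∣-cong-⇔ (notBelow? π i) (notBefore? ρ i) (rev i) m≈c)

  -- A competitor `σ` on one side is matched by `reverseOrder σ` on the other, where it has the same
  -- value. The hypothesis is applied to `σ` and its reverse in either order.
  maximal-reverseOrder : ∀ {a n} {X : Set a} (f g : Order X n → Carrier) →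
    (∀ π ρ → Reversed π ρ → f π ≈ g ρ) →
    ∀ π → (∀ σ → f σ ≤ f π) ⇔ (∀ σ → g σ ≤ g (reverseOrder π))
  maximal-reverseOrder f g f≈g π = mk⇔
    (λ max σ → ≤-resp₂-≈ (f∘reverse≈g σ) (f≈g∘reverse π) (max (reverseOrder σ)))
    (λ max σ → ≤-resp₂-≈ (sym (f≈g∘reverse σ)) (sym (f≈g∘reverse π)) (max (reverseOrder σ)))
    where
    f≈g∘reverse : ∀ σ → f σ ≈ g (reverseOrder σ)
    f≈g∘reverse σ = f≈g σ (reverseOrder σ) (reverseOrder-reversed σ)

    f∘reverse≈g : ∀ σ → f (reverseOrder σ) ≈ g σ
    f∘reverse≈g σ = f≈g (reverseOrder σ) σ
      (reversed-sym σ (reverseOrder σ) (reverseOrder-reversed σ))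

theorem9 : ∀ {c ℓ₁ ℓ₂ ℓ₃ a} (F : OrderedField c ℓ₁ ℓ₂ ℓ₃) →
    ((B : Set a) (n : ℕ) → n ≥ 1 → (enum : B ↔ Fin n) (I : Blocks F B) (π : Order B n) →
    IsOptimalStackingOrder F enum I π ⇔
    IsOptimalDropoutOrder F enum (blocks⇒airplanes F I) (reverseOrder π))
    ×
    ((A : Set a) (n : ℕ) → n ≥ 1 → (enum : A ↔ Fin n) (J : Airplanes F A) (π : Order A n) →
    IsOptimalDropoutOrder F enum J π ⇔
    IsOptimalStackingOrder F enum (airplanes⇒blocks F J) (reverseOrder π))
theorem9 F =
  (λ B n _ enum I → maximal-reverseOrder F _ _
    (overhang≈range F enum I (blocks⇒airplanes F I) (λ _ → refl) (λ _ → refl))) ,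
  -- Here the range comes first and the overhang second, so the equation and the relation are both
  -- turned around. The product of width and mass is `(v / c) * c`, which is `v` only up to `≈`.
  (λ A n _ enum J → let open Airplanes J in maximal-reverseOrder F _ _
    (λ π ρ rev → sym (overhang≈range F enum (airplanes⇒blocks F J) J
      (λ i → x/y*y≈x F (v i) (0<c i)) (λ _ → refl) ρ π (reversed-sym π ρ rev))))
  where open OrderedField F using (refl; sym)
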